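{- For every integer $t\ge 4$ there exists a constant $c_t$ such that every graph $G$ that contains no cycle of length at least $t$ as an induced subgraph has treewidth at most $c_t\Delta$, where $\Delta$ is the maximum degree of $G$. -}

module Defs where

open import Data.Nat using (ℕ; suc; _≤_; _⊔_; _+_)
open import Data.Fin using (Fin; toℕ)
open import Data.Fin.Subset using (Subset; _∈_; ∣_∣)
open import Data.Bool using (Bool; true; false)
open import Data.List using (foldr; map; allFin)
open import Data.Vec using (tabulate)
open import Data.Product using (_×_; ∃-syntax)
open import Data.Sum using (_⊎_)
open import Data.Unit using (⊤)
open import Relation.Nullary using (¬_)
open import Relation.Binary.PropositionalEquality using (_≡_)
open import Function.Definitions using (Injective)

record Graph : Set where
  field
    n      : ℕ
    adj    : Fin n → Fin n → Bool
    sym    : ∀ i j → adj i j ≡ adj j i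
    irrefl : ∀ i → adj i i ≡ false

open Graph public

Vertex : Graph → Set
Vertex G = Fin (n G)

Edge : (G : Graph) → Vertex G → Vertex G → Set
Edge G u v = adj G u v ≡ true

degree : (G : Graph) → Vertex G → ℕ
degree G v = ∣ tabulate (adj G v) ∣

maxDegree : (G : Graph) → ℕ
maxDegree G = foldr _⊔_ 0 (map (degree G) (allFin (n G)))

Consec : (ℓ : ℕ) → Fin ℓ → Fin ℓ → Set
Consec ℓ i j =
  (toℕ j ≡ suc (toℕ i)) ⊎ (toℕ i ≡ suc (toℕ j))
  ⊎ (toℕ i ≡ 0 × suc (toℕ j) ≡ ℓ) ⊎ (toℕ j ≡ 0 × suc (toℕ i) ≡ ℓ)

HasCycle : Graph → ℕ → Set
HasCycle G ℓ = 3 ≤ ℓ × ∃[ f ] (Injective _≡_ _≡_ f ×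
  (∀ (i j : Fin ℓ) → Consec ℓ i j → Edge G (f i) (f j)))

HasInducedCycle : Graph → ℕ → Set
HasInducedCycle G ℓ = 3 ≤ ℓ × ∃[ f ] (Injective _≡_ _≡_ f ×
  (∀ (i j : Fin ℓ) → (Consec ℓ i j → Edge G (f i) (f j)) × (Edge G (f i) (f j) → Consec ℓ i j)))

data Walk (G : Graph) (P : Vertex G → Set) : Vertex G → Vertex G → Set where
  here : ∀ {u} → P u → Walk G P u u
  step : ∀ {u w v} → P u → Edge G u w → Walk G P w v → Walk G P u v

Connected : Graph → Set
Connected G = ∀ u v → Walk G (λ _ → ⊤) u v

IsTree : Graph → Set
IsTree T = 1 ≤ n T × Connected T × (∀ ℓ → ¬ HasCycle T ℓ)

record TreeDecomposition (G : Graph) : Set where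
  field
    T        : Graph
    isTree   : IsTree T
    bag      : Vertex T → Subset (n G)
    covers   : ∀ v → ∃[ a ] (v ∈ bag a)
    edges    : ∀ u v → Edge G u v → ∃[ a ] (u ∈ bag a × v ∈ bag a)
    coherent : ∀ v a b → v ∈ bag a → v ∈ bag b → Walk T (λ x → v ∈ bag x) a b

TreewidthAtMost : Graph → ℕ → Set
TreewidthAtMost G k = ∃[ D ] (∀ a → ∣ TreeDecomposition.bag {G} D a ∣ ≤ k + 1)

module Submission where

-- Cops and robber: while the robber hides in a connected set C, the cops hold an induced path P whose
-- closed neighbourhood contains the boundary of C and avoids C.  If a boundary vertex is seen only from
-- the last vertex of P and another one only from the first, then closing P up through C yields an
-- induced cycle with at least |P| + 2 vertices.  So with |P| ≤ t − 2 one end can always be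
-- dropped or prolonged, and the bags N(C) ∪ (N[w] ∩ C), where w is the new end, lie in the closed
-- neighbourhood of a path with at most t − 2 vertices, which has at most (t − 2)Δ + 1 elements.

open import Defs renaming (sym to adj-sym)
open import Data.Bool using (true; false)
import Data.Bool.Properties as Bool
open import Data.Fin using (Fin; zero; suc; toℕ; fromℕ; fromℕ<; inject₁; punchOut)
open import Data.Fin.Properties
  using (_≟_; any?; toℕ-fromℕ; toℕ-fromℕ<; toℕ-inject₁; toℕ<n; punchIn-punchOut; punchOut-injective)
open import Data.Fin.Subset
  using (Subset; _∈_; _∉_; ∣_∣; _-_; _⊂_; _∪_; _∩_; ∁; ⁅_⁆; ⊥) renaming (⊤ to full)
open import Data.Fin.Subset.Induction using (⊂-wellFounded; Acc; acc)
open import Data.Fin.Subset.Properties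
open import Data.List using (List; []; _∷_; _++_; _∷ʳ_; length; lookup; initLast; _∷ʳ′_)
open import Data.List.Membership.Propositional using (lose)
open import Data.List.Membership.Propositional.Properties using (∈-allFin; ∈-lookup)
import Data.List.Properties as List
open import Data.List.Relation.Unary.All using (All; []; _∷_)
import Data.List.Relation.Unary.All as All
import Data.List.Relation.Unary.All.Properties as All
open import Data.List.Relation.Unary.Any using (Any; here; there)
import Data.List.Relation.Unary.Any as Any
import Data.List.Relation.Unary.Any.Properties as Any
open import Data.Nat using (ℕ; suc; _≤_; _<?_; _+_; _*_; z≤n; s≤s)
import Data.Nat.Properties as ℕ
open import Data.Product using (_×_; _,_; ∃-syntax; proj₁; proj₂)
open import Data.Sum using (_⊎_; inj₁; inj₂; [_,_])
open import Data.Unit using (tt)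
open import Data.Vec using ([]; _∷_; tabulate)
open import Data.Vec.Properties using (lookup∘tabulate; lookup⇒[]=; []=⇒lookup)
open import Function using (_∘_)
open import Function.Definitions using (Injective)
open import Relation.Binary.PropositionalEquality
  using (_≡_; _≢_; refl; sym; trans; cong; subst; subst₂)
open import Relation.Nullary
  using (¬_; Dec; yes; no; does; contradiction; map′; _×-dec_; _⊎-dec_; ¬?)
open import Relation.Nullary.Decidable using (decidable-stable; dec-true)
open import Relation.Unary using (Decidable)

-- Walks inside a vertex set and decidable reachability.

module Walks (G : Graph) where

  edge? : ∀ u v → Dec (Edge G u v)
  edge? u v = adj G u v Bool.≟ true

  edge-sym : ∀ {u v} → Edge G u v → Edge G v u
  edge-sym {u} {v} e = trans (adj-sym G v u) e

  edge-irrefl : ∀ {u} → ¬ Edge G u u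
  edge-irrefl {u} e with trans (sym e) (irrefl G u)
  ... | ()

  module _ {P : Vertex G → Set} where

    source : ∀ {u v} → Walk G P u v → P u
    source (here p)     = p
    source (step p _ _) = p

    target : ∀ {u v} → Walk G P u v → P v
    target (here p)     = p
    target (step _ _ w) = target w

    _⊕_ : ∀ {u v w} → Walk G P u v → Walk G P v w → Walk G P u w
    here _     ⊕ w = w
    step p e v ⊕ w = step p e (v ⊕ w)

    _▷[_]_ : ∀ {u v w} → Walk G P u v → Edge G v w → P w → Walk G P u w
    w ▷[ e ] p = w ⊕ step (target w) e (here p)

    reverse : ∀ {u v} → Walk G P u v → Walk G P v u
    reverse (here p)     = here p
    reverse (step p e w) = reverse w ▷[ edge-sym e ] p

  mapWalk : ∀ {P Q : Vertex G → Set} → (∀ {x} → P x → Q x) →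
            ∀ {u v} → Walk G P u v → Walk G Q u v
  mapWalk f (here p)     = here (f p)
  mapWalk f (step p e w) = step (f p) e (mapWalk f w)

  -- A walk that returns to u is cut at its last visit to u.
  avoid : ∀ {S : Subset (n G)} {w v} u → Walk G (_∈ S) w v →
          Walk G (_∈ S - u) w v ⊎ u ≡ v ⊎ (∃[ x ] (Edge G u x × Walk G (_∈ S - u) x v))
  avoid u (here {w} p) with w ≟ u
  ... | yes refl = inj₂ (inj₁ refl)
  ... | no w≢u   = inj₁ (here (x∈p∧x≢y⇒x∈p-y p w≢u))
  avoid u (step {w} {x} p e r) with avoid u r
  ... | inj₂ later = inj₂ later
  ... | inj₁ r′ with w ≟ u
  ...   | yes refl = inj₂ (inj₂ (x , e , r′))
  ...   | no w≢u   = inj₁ (step (x∈p∧x≢y⇒x∈p-y p w≢u) e r′)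

  -- By `avoid` a walk need never return to its source, so the search may delete `u` from `S` after
  -- leaving it. The recursion is then well-founded on `S`.
  walk? : (S : Subset (n G)) → ∀ u v → Dec (Walk G (_∈ S) u v)
  walk? S = go S (⊂-wellFounded S)
    where
    go : ∀ S → Acc _⊂_ S → ∀ u v → Dec (Walk G (_∈ S) u v)
    go S (acc rec) u v with u ∈? S
    ... | no u∉S  = no (u∉S ∘ source)
    ... | yes u∈S = map′ to from
        (u ≟ v ⊎-dec any? λ x → edge? u x ×-dec go (S - u) (rec (x∈p⇒p-x⊂p u∈S)) x v)
      where
      Split = u ≡ v ⊎ (∃[ x ] (Edge G u x × Walk G (_∈ S - u) x v))

      to : Split → Walk G (_∈ S) u v
      to (inj₁ refl)        = here u∈S
      to (inj₂ (x , e , w)) = step u∈S e (mapWalk (p─q⊆p S _) w)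

      from : Walk G (_∈ S) u v → Split
      from (here _)           = inj₁ refl
      from (step {w = x} _ e w) with avoid u w
      ... | inj₁ w′    = inj₂ (x , e , w′)
      ... | inj₂ split = split

-- Induced paths and how to extract them from walks.

module InducedPaths (G : Graph) where
  open Walks G

  Touches : List (Vertex G) → Vertex G → Set
  Touches P z = Any (λ p → p ≡ z ⊎ Edge G p z) P

  touches? : ∀ P z → Dec (Touches P z)
  touches? P z = Any.any? (λ p → p ≟ z ⊎-dec edge? p z) P

  -- Touching covers equality as well as adjacency, so the single condition `¬ Touches xs x` gives
  -- both distinct vertices and the absence of chords.
  data IPath : List (Vertex G) → Set where
    []   : IPath []
    [-]  : ∀ {x} → IPath (x ∷ [])
    cons : ∀ {x y xs} → Edge G x y → ¬ Touches xs x → IPath (y ∷ xs) → IPath (x ∷ y ∷ xs)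

  tail-IPath : ∀ {x xs} → IPath (x ∷ xs) → IPath xs
  tail-IPath [-]          = []
  tail-IPath (cons _ _ p) = p

  init-IPath : ∀ M {l} → IPath (M ∷ʳ l) → IPath M
  init-IPath []          _             = []
  init-IPath (x ∷ [])    _             = [-]
  init-IPath (x ∷ y ∷ M) (cons e ¬t p) = cons e (¬t ∘ Any.++⁺ˡ) (init-IPath (y ∷ M) p)

  touches-sym : ∀ {x z} → x ≡ z ⊎ Edge G x z → z ≡ x ⊎ Edge G z x
  touches-sym = [ inj₁ ∘ sym , inj₂ ∘ edge-sym ]

  untouched : ∀ {M x Q} → All (λ z → ¬ Touches (x ∷ M) z) Q → ¬ Touches Q x
  untouched (¬t ∷ _)  (here t)  = ¬t (here (touches-sym t))
  untouched (_ ∷ ¬ts) (there t) = untouched ¬ts t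

  join-IPath : ∀ M {l Q} → IPath (M ∷ʳ l) → IPath (l ∷ Q) →
               All (λ z → ¬ Touches M z) Q → IPath (M ∷ʳ l ++ Q)
  join-IPath []          _             q _   = q
  join-IPath (x ∷ [])    (cons e _ _)  q ¬ts = cons e (untouched ¬ts) q
  join-IPath (x ∷ y ∷ M) (cons e ¬t p) q ¬ts =
    cons e ([ ¬t , untouched ¬ts ] ∘ Any.++⁻ (M ∷ʳ _))
         (join-IPath (y ∷ M) p q (All.map (_∘ there) ¬ts))

  -- Only the final entry satisfies `T`. With `T` the adjacency to a further vertex `b`, such a path
  -- can be closed through `b` without a chord at `b`.
  data FirstHit (T : Vertex G → Set) : List (Vertex G) → Set where
    hit  : ∀ {x} → T x → FirstHit T (x ∷ [])
    miss : ∀ {x xs} → ¬ T x → FirstHit T xs → FirstHit T (x ∷ xs)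

  module _ {T : Vertex G → Set} where

    prepend : ∀ {M Q} → All (λ x → ¬ T x) M → FirstHit T Q → FirstHit T (M ++ Q)
    prepend []       h = h
    prepend (m ∷ ms) h = miss m (prepend ms h)

    FirstHit-nonempty : ∀ {L} → FirstHit T L → 1 ≤ length L
    FirstHit-nonempty (hit _)    = s≤s z≤n
    FirstHit-nonempty (miss _ _) = s≤s z≤n

    FirstHit⇒last : ∀ {L} → FirstHit T L → ∀ i → T (lookup L i) → suc (toℕ i) ≡ length L
    FirstHit⇒last (hit _)     zero    _ = refl
    FirstHit⇒last (miss ¬t _) zero    t = contradiction t ¬t
    FirstHit⇒last (miss _ h)  (suc i) t = cong suc (FirstHit⇒last h i t)

    last⇒FirstHit : ∀ {L} → FirstHit T L → ∀ i → suc (toℕ i) ≡ length L → T (lookup L i)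
    last⇒FirstHit (hit t)           zero    _  = t
    last⇒FirstHit (miss _ (hit _))    zero ()
    last⇒FirstHit (miss _ (miss _ _)) zero ()
    last⇒FirstHit (miss _ h)        (suc i) eq = last⇒FirstHit h i (ℕ.suc-injective eq)

  module _ {T P : Vertex G → Set} (T? : Decidable T) where

    -- The new path jumps from a to the last vertex of L that touches a.
    shortcut : ∀ {a L} → ¬ T a → Touches L a → IPath L → FirstHit T L → All P L →
               ∃[ Q ] (IPath (a ∷ Q) × FirstHit T (a ∷ Q) × All P Q)
    shortcut {a} {x ∷ xs} ¬ta t p h ps with touches? xs a
    shortcut ¬ta t p (miss _ h) (_ ∷ ps) | yes t′ = shortcut ¬ta t′ (tail-IPath p) h ps
    shortcut {L = x ∷ xs} ¬ta (here (inj₁ refl)) p h (_ ∷ ps) | no _ = xs , p , h , ps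
    shortcut {L = x ∷ xs} ¬ta (here (inj₂ e)) p h ps | no ¬t = x ∷ xs , cons (edge-sym e) ¬t p , miss ¬ta h , ps
    shortcut ¬ta (there t) p h ps | no ¬t = contradiction t ¬t

    -- Induction on the walk: the induced path from the next vertex is prolonged backwards to `u` by
    -- `shortcut`, and a vertex in `T` ends the path at once. The start `u` is exempt from `P`
    -- because in the application it is a boundary vertex, outside the territory.
    inducedPath : ∀ {u w v} → Edge G u w → Walk G P w v → T v →
                  ∃[ Q ] (IPath (u ∷ Q) × FirstHit T (u ∷ Q) × All P Q)
    inducedPath {u} e r t with T? u
    ... | yes tu = [] , [-] , hit tu , []
    inducedPath e (here p) t | no ¬tu =
      shortcut ¬tu (here (inj₂ (edge-sym e))) [-] (hit t) (p ∷ [])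
    inducedPath e (step p e′ r) t | no ¬tu =
      let _ , ip , h , ps = inducedPath e′ r t
      in shortcut ¬tu (here (inj₂ (edge-sym e))) ip h (p ∷ ps)

  -- From induced paths to induced cycles.

  touches-lookup : ∀ {L z} i → lookup L i ≡ z ⊎ Edge G (lookup L i) z → Touches L z
  touches-lookup i = lose (∈-lookup i)

  IPath-injective : ∀ {L} → IPath L → Injective _≡_ _≡_ (lookup L)
  IPath-injective {_ ∷ _} p {zero} {zero} _ = refl
  IPath-injective (cons e _ _) {zero} {suc zero} refl = contradiction e edge-irrefl
  IPath-injective (cons e _ _) {suc zero} {zero} refl = contradiction e edge-irrefl
  IPath-injective (cons _ ¬t _) {zero} {suc (suc j)} eq =
    contradiction (touches-lookup j (inj₁ (sym eq))) ¬t
  IPath-injective (cons _ ¬t _) {suc (suc i)} {zero} eq =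
    contradiction (touches-lookup i (inj₁ eq)) ¬t
  IPath-injective {_ ∷ _} p {suc i} {suc j} eq = cong suc (IPath-injective (tail-IPath p) eq)

  edge⇒consecutive : ∀ {L} → IPath L → ∀ i j → Edge G (lookup L i) (lookup L j) →
                     toℕ j ≡ suc (toℕ i) ⊎ toℕ i ≡ suc (toℕ j)
  edge⇒consecutive {_ ∷ _} p zero zero e = contradiction e edge-irrefl
  edge⇒consecutive {_ ∷ _ ∷ _} p zero (suc zero) e = inj₁ refl
  edge⇒consecutive {_ ∷ _ ∷ _} p (suc zero) zero e = inj₂ refl
  edge⇒consecutive (cons _ ¬t _) zero (suc (suc j)) e =
    contradiction (touches-lookup j (inj₂ (edge-sym e))) ¬t
  edge⇒consecutive (cons _ ¬t _) (suc (suc i)) zero e =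
    contradiction (touches-lookup i (inj₂ e)) ¬t
  edge⇒consecutive {_ ∷ _} p (suc i) (suc j) e =
    [ inj₁ ∘ cong suc , inj₂ ∘ cong suc ] (edge⇒consecutive (tail-IPath p) i j e)

  consecutive⇒edge : ∀ {L} → IPath L → ∀ i j → toℕ j ≡ suc (toℕ i) →
                     Edge G (lookup L i) (lookup L j)
  consecutive⇒edge (cons e _ _) zero (suc zero) _ = e
  consecutive⇒edge {_ ∷ _} p (suc i) (suc j) eq =
    consecutive⇒edge (tail-IPath p) i j (ℕ.suc-injective eq)
  consecutive⇒edge [] ()

  -- The vertex `b` takes index 0, so its cyclic neighbours are index 1, which is `v`, and the last
  -- index, which `FirstHit` singles out. All other pairs are settled by the induced path.
  closeCycle : ∀ {b v L} → IPath (v ∷ L) → Edge G b v → FirstHit (Edge G b) L →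
               All (b ≢_) L → HasInducedCycle G (2 + length L)
  closeCycle {b} {v} {L} p bv h b∉L = s≤s (s≤s (FirstHit-nonempty h)) , lookup (b ∷ v ∷ L) , inj , induced
    where
    b∉ : ∀ i → b ≢ lookup (v ∷ L) i
    b∉ zero    refl = edge-irrefl bv
    b∉ (suc i) = All.lookup b∉L (∈-lookup i)

    inj : Injective _≡_ _≡_ (lookup (b ∷ v ∷ L))
    inj {zero}  {zero}  _  = refl
    inj {zero}  {suc j} eq = contradiction eq (b∉ j)
    inj {suc i} {zero}  eq = contradiction (sym eq) (b∉ i)
    inj {suc i} {suc j} eq = cong suc (IPath-injective p eq)

    fromEdge : ∀ j → Edge G b (lookup (v ∷ L) j) → Consec (2 + length L) zero (suc j)
    fromEdge zero    _ = inj₁ refl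
    fromEdge (suc j) e = inj₂ (inj₂ (inj₁ (refl , cong (2 +_) (FirstHit⇒last h j e))))

    toEdge : ∀ j → Consec (2 + length L) zero (suc j) → Edge G b (lookup (v ∷ L) j)
    toEdge zero    _ = bv
    toEdge (suc j) (inj₁ ())
    toEdge (suc j) (inj₂ (inj₁ ()))
    toEdge (suc j) (inj₂ (inj₂ (inj₁ (_ , eq)))) =
      last⇒FirstHit h j (ℕ.suc-injective (ℕ.suc-injective eq))
    toEdge (suc j) (inj₂ (inj₂ (inj₂ (() , _))))

    consec-sym : ∀ {ℓ} {i j : Fin ℓ} → Consec ℓ i j → Consec ℓ j i
    consec-sym (inj₁ c)               = inj₂ (inj₁ c)
    consec-sym (inj₂ (inj₁ c))        = inj₁ c
    consec-sym (inj₂ (inj₂ (inj₁ c))) = inj₂ (inj₂ (inj₂ c))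
    consec-sym (inj₂ (inj₂ (inj₂ c))) = inj₂ (inj₂ (inj₁ c))

    induced : ∀ i j → let f = lookup (b ∷ v ∷ L); ℓ = 2 + length L in
              (Consec ℓ i j → Edge G (f i) (f j)) × (Edge G (f i) (f j) → Consec ℓ i j)
    induced zero zero = loop , λ e → contradiction e edge-irrefl
      where
      loop : Consec (2 + length L) zero zero → Edge G b b
      loop (inj₁ ())
      loop (inj₂ (inj₁ ()))
      loop (inj₂ (inj₂ (inj₁ (_ , ()))))
      loop (inj₂ (inj₂ (inj₂ (_ , ()))))
    induced zero (suc j) = toEdge j , fromEdge j
    induced (suc i) zero =
      edge-sym ∘ toEdge i ∘ consec-sym , consec-sym ∘ fromEdge i ∘ edge-sym
    induced (suc i) (suc j) = to , from ∘ edge⇒consecutive p i j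
      where
      to : Consec (2 + length L) (suc i) (suc j) → Edge G (lookup (v ∷ L) i) (lookup (v ∷ L) j)
      to (inj₁ eq) = consecutive⇒edge p i j (ℕ.suc-injective eq)
      to (inj₂ (inj₁ eq)) = edge-sym (consecutive⇒edge p j i (ℕ.suc-injective eq))
      to (inj₂ (inj₂ (inj₁ (() , _))))
      to (inj₂ (inj₂ (inj₂ (() , _))))

      from : toℕ j ≡ suc (toℕ i) ⊎ toℕ i ≡ suc (toℕ j) → Consec (2 + length L) (suc i) (suc j)
      from (inj₁ eq) = inj₁ (cong suc eq)
      from (inj₂ eq) = inj₂ (inj₁ (cong suc eq))

  -- Guarding a connected territory by an induced path.

  module Territory (C : Vertex G → Set) (C? : Decidable C)
                   (linked : ∀ {x y} → C x → C y → Walk G C x y) where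

    Boundary : Vertex G → Set
    Boundary z = ¬ C z × (∃[ y ] (C y × Edge G y z))

    boundary? : Decidable Boundary
    boundary? z = ¬? (C? z) ×-dec any? λ y → C? y ×-dec edge? y z

    Guards : List (Vertex G) → Set
    Guards P = ∀ {z} → Boundary z → Touches P z

    Avoids : List (Vertex G) → Set
    Avoids P = ∀ {y} → C y → ¬ Touches P y

    guards-or-private : ∀ P → Guards P ⊎ (∃[ z ] (Boundary z × ¬ Touches P z))
    guards-or-private P with any? (λ z → boundary? z ×-dec ¬? (touches? P z))
    ... | yes found  = inj₂ found
    ... | no ¬found = inj₁ λ {z} bz → decidable-stable (touches? P z) (λ ¬t → ¬found (z , bz , ¬t))

    -- A vertex of P has no neighbour in C, so it is not a boundary vertex.
    boundary-edge : ∀ {P p z} → Avoids (p ∷ P) → Boundary z → p ≡ z ⊎ Edge G p z → Edge G p z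
    boundary-edge off (_ , y , cy , e) (inj₁ refl) =
      contradiction (here (inj₂ (edge-sym e))) (off cy)
    boundary-edge off _ (inj₂ e) = e

    -- The cycle runs through `b`, `v`, `M`, `l`, `a` and then along `Q` inside `C` up to the first
    -- neighbour of `b`. Chords are excluded because `a` sees only `l` on the guarding path, `b`
    -- sees only `v`, and `C` sees none of it. If `a` and `b` are adjacent, `Q` is empty and the
    -- length is the least possible.
    longCycle : ∀ {v l a b} M → IPath (v ∷ M ∷ʳ l) → Avoids (v ∷ M ∷ʳ l) →
                Boundary a → Edge G l a → ¬ Touches (v ∷ M) a →
                Boundary b → Edge G v b → ¬ Touches (M ∷ʳ l) b →
                ∃[ ℓ ] (2 + length (v ∷ M ∷ʳ l) ≤ ℓ × HasInducedCycle G ℓ)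
    longCycle {v} {l} {a} {b} M p off (¬ca , y , cy , ya) la ¬ta (¬cb , y′ , cy′ , y′b) vb ¬tb
      with inducedPath (edge? b) (edge-sym ya) (linked cy cy′) (edge-sym y′b)
    ... | Q , q , h , qs = _ , long , closeCycle path (edge-sym vb) hits b∉
      where
      path : IPath ((v ∷ M) ∷ʳ l ++ a ∷ Q)
      path = join-IPath (v ∷ M) p
        -- The vertices of `Q` lie in `C`, which the guarding path avoids; hence `l` touches none of
        -- them.
        (cons la (untouched {M = []} (All.map (λ c → off c ∘ Any.++⁺ʳ (v ∷ M)) qs)) q)
        (¬ta ∷ All.map (λ c → off c ∘ Any.++⁺ˡ) qs)

      ¬touch-b : All (λ p → ¬ (p ≡ b ⊎ Edge G p b)) (M ∷ʳ l)
      ¬touch-b = All.¬Any⇒All¬ (M ∷ʳ l) ¬tb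

      hits : FirstHit (Edge G b) (M ∷ʳ l ++ a ∷ Q)
      hits = prepend (All.map (_∘ inj₂ ∘ edge-sym) ¬touch-b) h

      b∉ : All (b ≢_) (M ∷ʳ l ++ a ∷ Q)
      b∉ = All.++⁺ (All.map (_∘ inj₁ ∘ sym) ¬touch-b)
             -- `a` differs from `b` since `v` sees only `b`, and `Q` misses `b` since `b` lies
             -- outside `C`.
             ((λ { refl → ¬ta (here (inj₂ vb)) }) ∷ All.map (λ { c refl → ¬cb c }) qs)

      long : 2 + length (v ∷ M ∷ʳ l) ≤ 2 + length (M ∷ʳ l ++ a ∷ Q)
      long = s≤s (s≤s (begin
        suc (length (M ∷ʳ l))            ≤⟨ s≤s (ℕ.m≤m+n _ (length Q)) ⟩
        suc (length (M ∷ʳ l) + length Q) ≡⟨ ℕ.+-suc _ _ ⟨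
        length (M ∷ʳ l) + suc (length Q) ≡⟨ List.length-++ (M ∷ʳ l) ⟨
        length (M ∷ʳ l ++ a ∷ Q)         ∎))
        where open ℕ.≤-Reasoning

    -- Guarding and avoiding are asked of `P` alone, because the new end `w` lies in `C` or next to
    -- it. The vertex `y` will leave the territory, which ensures progress; `short` counts `w`
    -- because the new bag lies in the closed neighbourhood of `w ∷ P`.
    record Extension (s : ℕ) : Set where
      field
        {w y}  : Vertex G
        {P}    : List (Vertex G)
        isPath : IPath (w ∷ P)
        short  : length (w ∷ P) ≤ s
        guards : Guards P
        avoids : Avoids P
        y∈C    : C y
        meets  : w ≡ y ⊎ Edge G w y

    -- Vertices are dropped from the front until the first one, `v`, has a private boundary vertex
    -- `b`. Then `b` becomes the new end: being private, it keeps the path induced, and being a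
    -- boundary vertex, it has a neighbour in `C`.
    extend : ∀ {s c} → C c → 2 ≤ s → (∀ ℓ → 2 + s ≤ ℓ → ¬ HasInducedCycle G ℓ) →
             ∀ P → IPath P → length P ≤ s → Guards P → Avoids P → Extension s
    -- If the empty path guards, `C` has no boundary, and any vertex of `C` may start a new path.
    extend cc 2≤s _ [] _ _ guards _ = record
      { isPath = [-] ; short = ℕ.≤-trans (s≤s z≤n) 2≤s
      ; guards = guards ; avoids = λ _ () ; y∈C = cc ; meets = inj₁ refl }
    extend {s} cc 2≤s noCycle (v ∷ P) p len guards off with guards-or-private P
    ... | inj₁ guards′ =
      extend cc 2≤s noCycle P (tail-IPath p) (ℕ.≤-trans (ℕ.n≤1+n _) len) guards′ (λ cy → off cy ∘ there)
    ... | inj₂ (b , bb@(_ , y , cy , yb) , ¬tb) = grow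
      where
      vb : Edge G v b
      vb = boundary-edge off bb (Any.head ¬tb (guards bb))

      grow : Extension s
      grow with length (v ∷ P) <? s
      ... | yes short = record
        { isPath = cons (edge-sym vb) ¬tb p ; short = short
        ; guards = guards ; avoids = off ; y∈C = cy ; meets = inj₂ (edge-sym yb) }
      ... | no full with initLast P
      ...   | [] = contradiction 2≤s full
      -- At full length, room for `b` is made by dropping `l`. If `l` cannot be spared, it has a
      -- private boundary vertex too, and the cycle of `longCycle` is too long.
      ...   | M ∷ʳ′ l with guards-or-private (v ∷ M)
      ...     | inj₁ guards′ = record
        { isPath = cons (edge-sym vb) (¬tb ∘ Any.++⁺ˡ) (init-IPath (v ∷ M) p)
        ; short = ℕ.≤-trans (s≤s (ℕ.≤-reflexive ∣vM∣≡∣Ml∣)) len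
        ; guards = guards′ ; avoids = λ cy → off cy ∘ Any.++⁺ˡ
        ; y∈C = cy ; meets = inj₂ (edge-sym yb) }
        where
        ∣vM∣≡∣Ml∣ : length (v ∷ M) ≡ length (M ∷ʳ l)
        ∣vM∣≡∣Ml∣ = trans (ℕ.+-comm 1 (length M)) (sym (List.length-++ M))
      ...     | inj₂ (a , ba , ¬ta) =
        let ℓ , long , cycle = longCycle M p off ba la ¬ta bb vb ¬tb
        in contradiction cycle (noCycle ℓ (ℕ.≤-trans (s≤s (s≤s (ℕ.≮⇒≥ full))) long))
        where
        la : Edge G l a
        la with Any.++⁻ (v ∷ M) (guards ba)
        ... | inj₁ t        = contradiction t ¬ta
        ... | inj₂ (here t) = boundary-edge (λ cy → off cy ∘ Any.++⁺ʳ (v ∷ M)) ba t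

-- Subsets from decidable predicates, and the size of the closed neighbourhood of a path.

does⇒ : ∀ {A : Set} (d : Dec A) → does d ≡ true → A
does⇒ (yes a) _ = a

module _ {n : ℕ} {P : Fin n → Set} (P? : Decidable P) where

  ⟦_⟧ : Subset n
  ⟦_⟧ = tabulate (λ v → does (P? v))

  ∈⟦⟧⁺ : ∀ {v} → P v → v ∈ ⟦_⟧
  ∈⟦⟧⁺ {v} p = lookup⇒[]= v _ (trans (lookup∘tabulate _ v) (dec-true (P? v) p))

  ∈⟦⟧⁻ : ∀ {v} → v ∈ ⟦_⟧ → P v
  ∈⟦⟧⁻ {v} v∈ = does⇒ (P? v) (trans (sym (lookup∘tabulate _ v)) ([]=⇒lookup v∈))

∣p∪q∣≤∣p∣+∣q∣ : ∀ {n} (p q : Subset n) → ∣ p ∪ q ∣ ≤ ∣ p ∣ + ∣ q ∣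
∣p∪q∣≤∣p∣+∣q∣ []          []          = z≤n
∣p∪q∣≤∣p∣+∣q∣ (false ∷ p) (false ∷ q) = ∣p∪q∣≤∣p∣+∣q∣ p q
∣p∪q∣≤∣p∣+∣q∣ (false ∷ p) (true ∷ q)  =
  ℕ.≤-trans (s≤s (∣p∪q∣≤∣p∣+∣q∣ p q)) (ℕ.≤-reflexive (sym (ℕ.+-suc _ _)))
∣p∪q∣≤∣p∣+∣q∣ (true ∷ p)  (false ∷ q) = s≤s (∣p∪q∣≤∣p∣+∣q∣ p q)
∣p∪q∣≤∣p∣+∣q∣ (true ∷ p)  (true ∷ q)  =
  s≤s (ℕ.≤-trans (∣p∪q∣≤∣p∣+∣q∣ p q) (ℕ.+-monoʳ-≤ ∣ p ∣ (ℕ.n≤1+n _)))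

module Neighbourhoods (G : Graph) where
  open Walks G
  open InducedPaths G

  degree≤maxDegree : ∀ v → degree G v ≤ maxDegree G
  degree≤maxDegree v = List.foldr-preservesᵒ {P = degree G v ≤_}
    (λ x y → [ (λ le → ℕ.m≤n⇒m≤n⊔o y le) , (λ le → ℕ.m≤n⇒m≤o⊔n x le) ]) 0 _
    (inj₂ (Any.map⁺ (lose (∈-allFin v) ℕ.≤-refl)))

  N : Vertex G → Subset (n G)
  N v = tabulate (adj G v)

  ∈N : ∀ {u v} → Edge G u v → v ∈ N u
  ∈N {u} {v} e = lookup⇒[]= v _ (trans (lookup∘tabulate (adj G u) v) e)

  -- Only the last vertex is added by hand: every other vertex of a path is a neighbour of its
  -- successor. This gives the bound `length P * maxDegree G + 1` with a single extra 1, exactly the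
  -- one by which bag size exceeds width.
  N[_] : List (Vertex G) → Subset (n G)
  N[ [] ]        = ⊥
  N[ x ∷ [] ]    = ⁅ x ⁆ ∪ N x
  N[ x ∷ y ∷ P ] = N x ∪ N[ y ∷ P ]

  touches⇒∈N[] : ∀ {P z} → IPath P → Touches P z → z ∈ N[ P ]
  touches⇒∈N[] [-] (here (inj₁ refl)) = x∈p∪q⁺ (inj₁ (x∈⁅x⁆ _))
  touches⇒∈N[] [-] (here (inj₂ e))    = x∈p∪q⁺ {p = ⁅ _ ⁆} (inj₂ (∈N e))
  touches⇒∈N[] (cons {x} e _ p) (here (inj₁ refl)) =
    x∈p∪q⁺ {p = N x} (inj₂ (touches⇒∈N[] p (here (inj₂ (edge-sym e)))))
  touches⇒∈N[] (cons _ _ p) (here (inj₂ e)) = x∈p∪q⁺ (inj₁ (∈N e))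
  touches⇒∈N[] (cons {x} _ _ p) (there t) = x∈p∪q⁺ {p = N x} (inj₂ (touches⇒∈N[] p t))

  ∣N[]∣≤ : ∀ P → ∣ N[ P ] ∣ ≤ length P * maxDegree G + 1
  ∣N[]∣≤ [] = ℕ.≤-trans (ℕ.≤-reflexive (∣⊥∣≡0 (n G))) z≤n
  ∣N[]∣≤ (x ∷ []) = begin
    ∣ ⁅ x ⁆ ∪ N x ∣       ≤⟨ ∣p∪q∣≤∣p∣+∣q∣ ⁅ x ⁆ (N x) ⟩
    ∣ ⁅ x ⁆ ∣ + degree G x ≡⟨ ℕ.+-comm ∣ ⁅ x ⁆ ∣ _ ⟩
    degree G x + ∣ ⁅ x ⁆ ∣ ≡⟨ cong (degree G x +_) (∣⁅x⁆∣≡1 x) ⟩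
    degree G x + 1         ≤⟨ ℕ.+-monoˡ-≤ 1 (degree≤maxDegree x) ⟩
    maxDegree G + 1        ≡⟨ cong (_+ 1) (ℕ.*-identityˡ (maxDegree G)) ⟨
    1 * maxDegree G + 1    ∎
    where open ℕ.≤-Reasoning
  ∣N[]∣≤ (x ∷ y ∷ P) = begin
    ∣ N x ∪ N[ y ∷ P ] ∣                               ≤⟨ ∣p∪q∣≤∣p∣+∣q∣ (N x) N[ y ∷ P ] ⟩
    degree G x + ∣ N[ y ∷ P ] ∣                        ≤⟨ ℕ.+-mono-≤ (degree≤maxDegree x) (∣N[]∣≤ (y ∷ P)) ⟩
    maxDegree G + (length (y ∷ P) * maxDegree G + 1) ≡⟨ ℕ.+-assoc (maxDegree G) _ 1 ⟨
    length (x ∷ y ∷ P) * maxDegree G + 1             ∎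
    where open ℕ.≤-Reasoning

-- Attaching a leaf to a tree.

consec-neighbours : ∀ {ℓ} → 3 ≤ ℓ → (i : Fin ℓ) → ∃[ j ] ∃[ k ] (j ≢ k × Consec ℓ i j × Consec ℓ i k)
consec-neighbours (s≤s (s≤s (s≤s {n = m} _))) zero =
  suc zero , fromℕ (2 + m) , (λ ()) , inj₁ refl , inj₂ (inj₂ (inj₁ (refl , cong suc (toℕ-fromℕ _))))
consec-neighbours {suc ℓ} (s≤s 2≤ℓ) (suc i) with suc (toℕ i) <? ℓ
... | yes i+1<ℓ =
  inject₁ i , fromℕ< (s≤s i+1<ℓ) , distinct , inj₂ (inj₁ (cong suc (sym (toℕ-inject₁ i)))) ,
  inj₁ (toℕ-fromℕ< (s≤s i+1<ℓ))
  where
  distinct : inject₁ i ≢ fromℕ< (s≤s i+1<ℓ)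
  distinct eq = ℕ.m≢1+n+m (toℕ i)
    (trans (sym (toℕ-inject₁ i)) (trans (cong toℕ eq) (toℕ-fromℕ< (s≤s i+1<ℓ))))
-- The last index wraps round to `zero`, which is not its predecessor because the cycle length
-- `suc ℓ` is at least 3.
... | no i+1≮ℓ =
  inject₁ i , zero , distinct , inj₂ (inj₁ (cong suc (sym (toℕ-inject₁ i)))) ,
  inj₂ (inj₂ (inj₂ (refl , cong suc i+1≡ℓ)))
  where
  i+1≡ℓ : suc (toℕ i) ≡ ℓ
  i+1≡ℓ = ℕ.≤-antisym (toℕ<n i) (ℕ.≮⇒≥ i+1≮ℓ)

  distinct : inject₁ i ≢ zero
  distinct eq = contradiction
    (subst (2 ≤_) (trans (sym i+1≡ℓ) (cong suc (trans (sym (toℕ-inject₁ i)) (cong toℕ eq)))) 2≤ℓ)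
    λ { (s≤s ()) }

module _ (T : Graph) (p : Vertex T) where

  addLeaf : Graph
  n addLeaf = suc (n T)
  adj addLeaf zero    zero    = false
  adj addLeaf zero    (suc j) = does (p ≟ j)
  adj addLeaf (suc i) zero    = does (p ≟ i)
  adj addLeaf (suc i) (suc j) = adj T i j
  adj-sym addLeaf zero    zero    = refl
  adj-sym addLeaf zero    (suc j) = refl
  adj-sym addLeaf (suc i) zero    = refl
  adj-sym addLeaf (suc i) (suc j) = adj-sym T i j
  irrefl addLeaf zero    = refl
  irrefl addLeaf (suc i) = irrefl T i

  open Walks addLeaf using (_▷[_]_; edge-sym)

  leaf-edge : Edge addLeaf zero (suc p)
  leaf-edge = dec-true (p ≟ p) refl

  leaf-neighbour : ∀ {x} → Edge addLeaf zero x → x ≡ suc p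
  leaf-neighbour {suc j} e = cong suc (sym (does⇒ (p ≟ j) e))

  module _ {Q : Vertex addLeaf → Set} where

    liftWalk : ∀ {a b} → Walk T (Q ∘ suc) a b → Walk addLeaf Q (suc a) (suc b)
    liftWalk (here q)     = here q
    liftWalk (step q e w) = step q e (liftWalk w)

    -- Serves both connectivity of the tree, with `Q` trivial, and coherence of the bags, with `Q`
    -- the nodes whose bag contains a given vertex.
    addLeaf-walks : (Q zero → Q (suc p) ⊎ (∀ a → ¬ Q (suc a))) →
                    (∀ a b → Q (suc a) → Q (suc b) → Walk T (Q ∘ suc) a b) →
                    ∀ a b → Q a → Q b → Walk addLeaf Q a b
    addLeaf-walks leaf old zero zero qa _ = here qa
    addLeaf-walks leaf old (suc a) (suc b) qa qb = liftWalk (old a b qa qb)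
    addLeaf-walks leaf old zero (suc b) qa qb with leaf qa
    ... | inj₁ qp  = step qa leaf-edge (liftWalk (old p b qp qb))
    ... | inj₂ ¬qs = contradiction qb (¬qs b)
    addLeaf-walks leaf old (suc a) zero qa qb with leaf qb
    ... | inj₁ qp  = liftWalk (old a p qa qp) ▷[ edge-sym {zero} {suc p} leaf-edge ] qb
    ... | inj₂ ¬qs = contradiction qa (¬qs a)

  -- A cycle through the new leaf would have two distinct neighbours there.
  addLeaf-acyclic : (∀ ℓ → ¬ HasCycle T ℓ) → ∀ ℓ → ¬ HasCycle addLeaf ℓ
  addLeaf-acyclic acyclic ℓ (3≤ℓ , f , f-inj , f-edge) with any? (λ i → f i ≟ zero)
  ... | yes (i , fi≡0) with consec-neighbours 3≤ℓ i
  ...   | j , k , j≢k , ij , ik = j≢k (f-inj (trans (at-p ij) (sym (at-p ik))))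
    where
    at-p : ∀ {j} → Consec ℓ i j → f j ≡ suc p
    at-p {j} c = leaf-neighbour (subst (λ x → Edge addLeaf x (f j)) fi≡0 (f-edge i j c))
  addLeaf-acyclic acyclic ℓ (3≤ℓ , f , f-inj , f-edge) | no f≢0 =
    acyclic ℓ (3≤ℓ , (λ i → punchOut (0≢f i)) , f-inj ∘ punchOut-injective (0≢f _) (0≢f _) ,
      λ i j c → subst₂ (Edge addLeaf) (sym (punchIn-punchOut (0≢f i))) (sym (punchIn-punchOut (0≢f j)))
                       (f-edge i j c))
    where
    0≢f : ∀ i → zero ≢ f i
    0≢f i 0≡fi = f≢0 (i , sym 0≡fi)

  addLeaf-isTree : IsTree T → IsTree addLeaf
  addLeaf-isTree (_ , conn , acyclic) =
    s≤s z≤n , (λ a b → addLeaf-walks (λ _ → inj₁ tt) (λ a b _ _ → conn a b) a b tt tt) ,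
    addLeaf-acyclic acyclic

-- Building the tree decomposition leaf by leaf.

module Decompose (G : Graph) (s : ℕ) (2≤s : 2 ≤ s)
                 (noCycle : ∀ ℓ → 2 + s ≤ ℓ → ¬ HasInducedCycle G ℓ) where
  open Walks G
  open InducedPaths G
  open Neighbourhoods G

  Component : Subset (n G) → Vertex G → Vertex G → Set
  Component U x = Walk G (_∈ U) x

  linked : ∀ {U x y z} → Component U x y → Component U x z → Walk G (Component U x) y z
  linked {U} {x} xy xz = confine xy (reverse xy ⊕ xz)
    where
    confine : ∀ {y z} → Component U x y → Walk G (_∈ U) y z → Walk G (Component U x) y z
    confine xy (here _)     = here xy
    confine xy (step _ e w) = step xy e (confine (xy ▷[ e ] source w) w)

  module Comp (U : Subset (n G)) (x : Vertex G) = Territory (Component U x) (walk? U x) linked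

  -- A position of the cops against a robber in the component of `x`. By `inBag`, the node with bag
  -- `B` is a place where the next leaf can be attached.
  record Guide (U : Subset (n G)) (x : Vertex G) (B : Subset (n G)) : Set where
    field
      path    : List (Vertex G)
      isPath  : IPath path
      short   : length path ≤ s
      guards  : Comp.Guards U x path
      avoids  : Comp.Avoids U x path
      inBag   : ∀ {z} → Comp.Boundary U x z → z ∈ B

  -- A tree decomposition of `G` minus `U`, with a guide for every component of `U`. That no bag
  -- meets `U` keeps a vertex coherent when it first appears in a new leaf.
  record Partial (U : Subset (n G)) : Set where
    field
      T        : Graph
      isTree   : IsTree T
      bag      : Vertex T → Subset (n G)
      small    : ∀ a → ∣ bag a ∣ ≤ s * maxDegree G + 1
      covered  : ∀ {v} → v ∉ U → ∃[ a ] (v ∈ bag a)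
      fresh    : ∀ {v} → v ∈ U → ∀ a → v ∉ bag a
      edges    : ∀ {u v} → Edge G u v → u ∉ U → v ∉ U → ∃[ a ] (u ∈ bag a × v ∈ bag a)
      coherent : ∀ v a b → v ∈ bag a → v ∈ bag b → Walk T (λ x → v ∈ bag x) a b
      guide    : ∀ {x} → x ∈ U → ∃[ a ] Guide U x (bag a)

  -- A tree needs a node, hence one empty bag. The territories are whole components of `G`, so the
  -- empty path guards them.
  initial : Partial full
  initial = record
    { T = point
    ; isTree = s≤s z≤n , (λ { zero zero → here tt }) , acyclic
    ; bag = λ _ → ⊥
    ; small = λ _ → ℕ.≤-trans (ℕ.≤-reflexive (∣⊥∣≡0 (n G))) z≤n
    ; covered = λ v∉ → contradiction ∈⊤ v∉
    ; fresh = λ _ _ → ∉⊥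
    ; edges = λ _ u∉ _ → contradiction ∈⊤ u∉
    ; coherent = λ _ _ _ v∈⊥ _ → contradiction v∈⊥ ∉⊥
    ; guide = λ {x} _ → zero , record
        { path = [] ; isPath = [] ; short = z≤n
        ; guards = λ b → contradiction b no-boundary
        ; avoids = λ _ ()
        ; inBag = λ b → contradiction b no-boundary
        }
    }
    where
    point : Graph
    point = record { n = 1 ; adj = λ _ _ → false ; sym = λ _ _ → refl ; irrefl = λ _ → refl }

    acyclic : ∀ ℓ → ¬ HasCycle point ℓ
    acyclic ℓ (3≤ℓ , f , _ , f-edge) with f-edge i j (proj₁ (proj₂ (proj₂ cs)))
      where
      i = fromℕ< (ℕ.≤-trans (s≤s z≤n) 3≤ℓ)
      cs = proj₂ (consec-neighbours 3≤ℓ i)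
      j = proj₁ (consec-neighbours 3≤ℓ i)
    ... | ()

    no-boundary : ∀ {x z} → ¬ Comp.Boundary full x z
    no-boundary (¬xz , y , xy , e) = ¬xz (xy ▷[ e ] ∈⊤)

  module Step {U : Subset (n G)} (D : Partial U) {x : Vertex G} (x∈U : x ∈ U) where
    open Partial D
    open Comp U x using (Boundary; boundary?; Extension; module Extension; extend)

    C : Vertex G → Set
    C = Component U x

    a₀ : Vertex T
    a₀ = proj₁ (guide x∈U)
    open Guide (proj₂ (guide x∈U)) using (inBag)

    extension : Extension s
    extension = extend (here x∈U) 2≤s noCycle path isPath short guards avoids
      where open Guide (proj₂ (guide x∈U))

    open Extension extension

    InBag : Vertex G → Set
    InBag z = Boundary z ⊎ C z × (w ≡ z ⊎ Edge G w z)

    inBag? : Decidable InBag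
    inBag? z = boundary? z ⊎-dec walk? U x z ×-dec (w ≟ z ⊎-dec edge? w z)

    B : Subset (n G)
    B = ⟦ inBag? ⟧

    U′ : Subset (n G)
    U′ = U ∩ ∁ B

    U′⊆U : ∀ {v} → v ∈ U′ → v ∈ U
    U′⊆U v∈ = proj₁ (x∈p∩q⁻ U (∁ B) v∈)

    U′∌B : ∀ {v} → v ∈ U′ → v ∉ B
    U′∌B v∈ = x∈∁p⇒x∉p (proj₂ (x∈p∩q⁻ U (∁ B) v∈))

    removed : ∀ {v} → v ∈ U → v ∉ U′ → v ∈ B
    removed {v} v∈U v∉U′ = decidable-stable (v ∈? B) λ v∉B →
      v∉U′ (x∈p∩q⁺ (v∈U , x∉p⇒x∈∁p v∉B))

    boundary∉U : ∀ {z} → Boundary z → z ∉ U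
    boundary∉U (¬cz , y , cy , e) z∈U = ¬cz (cy ▷[ e ] z∈U)

    -- A boundary vertex in `U` would be reachable, hence in `C`. The step therefore removes
    -- vertices from the territory `C` only.
    B∩U⊆C : ∀ {z} → z ∈ B → z ∈ U → C z
    B∩U⊆C z∈B z∈U with ∈⟦⟧⁻ inBag? z∈B
    ... | inj₁ b       = contradiction z∈U (boundary∉U b)
    ... | inj₂ (c , _) = c

    B⇒touches : ∀ {z} → z ∈ B → Touches (w ∷ P) z
    B⇒touches z∈B with ∈⟦⟧⁻ inBag? z∈B
    ... | inj₁ b       = there (guards b)
    ... | inj₂ (_ , t) = here t

    U′⊂U : U′ ⊂ U
    U′⊂U = U′⊆U , y , target y∈C , λ y∈U′ → U′∌B y∈U′ (∈⟦⟧⁺ inBag? (inj₂ (y∈C , meets)))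

    bag′ : Vertex (addLeaf T a₀) → Subset (n G)
    bag′ zero    = B
    bag′ (suc a) = bag a

    small′ : ∀ a → ∣ bag′ a ∣ ≤ s * maxDegree G + 1
    small′ zero = begin
      ∣ B ∣                                ≤⟨ p⊆q⇒∣p∣≤∣q∣ (touches⇒∈N[] isPath ∘ B⇒touches) ⟩
      ∣ N[ w ∷ P ] ∣                       ≤⟨ ∣N[]∣≤ (w ∷ P) ⟩
      length (w ∷ P) * maxDegree G + 1     ≤⟨ ℕ.+-monoˡ-≤ 1 (ℕ.*-monoˡ-≤ (maxDegree G) short) ⟩
      s * maxDegree G + 1                  ∎
      where open ℕ.≤-Reasoning
    small′ (suc a) = small a

    covered′ : ∀ {v} → v ∉ U′ → ∃[ a ] (v ∈ bag′ a)
    covered′ {v} v∉U′ with v ∈? U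
    ... | yes v∈U = zero , removed v∈U v∉U′
    ... | no v∉U  = let a , v∈a = covered v∉U in suc a , v∈a

    fresh′ : ∀ {v} → v ∈ U′ → ∀ a → v ∉ bag′ a
    fresh′ v∈U′ zero    = U′∌B v∈U′
    fresh′ v∈U′ (suc a) = fresh (U′⊆U v∈U′) a

    -- The end `u` lies in `C`; the other end is either removed in the same step or lies outside
    -- `U`, and is then a boundary vertex of `C`.
    newEdge : ∀ {u v} → Edge G u v → u ∈ U → u ∉ U′ → v ∉ U′ → u ∈ B × v ∈ B
    newEdge {u} {v} e u∈U u∉U′ v∉U′ = u∈B , v∈B
      where
      u∈B = removed u∈U u∉U′
      v∈B : v ∈ B
      v∈B with v ∈? U
      ... | yes v∈U = removed v∈U v∉U′
      ... | no v∉U  = ∈⟦⟧⁺ inBag? (inj₁ (v∉U ∘ target , u , B∩U⊆C u∈B u∈U , e))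

    edges′ : ∀ {u v} → Edge G u v → u ∉ U′ → v ∉ U′ → ∃[ a ] (u ∈ bag′ a × v ∈ bag′ a)
    edges′ {u} {v} e u∉ v∉ with u ∈? U | v ∈? U
    ... | yes u∈U | _       = zero , newEdge e u∈U u∉ v∉
    ... | no _    | yes v∈U = let v∈B , u∈B = newEdge (edge-sym e) v∈U v∉ u∉ in zero , u∈B , v∈B
    ... | no u∉U  | no v∉U  = let a , both = edges e u∉U v∉U in suc a , both

    -- Boundary vertices already lie in the bag of the parent `a₀`; the remaining vertices of `B`
    -- come from `U` and occur in no older bag.
    coherent′ : ∀ v a b → v ∈ bag′ a → v ∈ bag′ b → Walk (addLeaf T a₀) (λ x → v ∈ bag′ x) a b
    coherent′ v = addLeaf-walks T a₀ leaf (coherent v)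
      where
      leaf : v ∈ B → v ∈ bag a₀ ⊎ (∀ a → v ∉ bag a)
      leaf v∈B with ∈⟦⟧⁻ inBag? v∈B
      ... | inj₁ b       = inj₁ (inBag b)
      ... | inj₂ (c , _) = inj₂ (fresh (target c))

    -- A component inside `C` is guarded by `w ∷ P` from the new leaf: its boundary lies in `B`, and
    -- the part of `C` touched by `w` is gone. A component outside `C` keeps its old guide.
    guide′ : ∀ {x′} → x′ ∈ U′ → ∃[ a ] Guide U′ x′ (bag′ a)
    guide′ {x′} x′∈U′ with walk? U x x′
    ... | yes cx′ = zero , record
      { path = w ∷ P ; isPath = isPath ; short = short
      ; guards = B⇒touches ∘ boundary⇒B
      ; avoids = λ { z (here t)  → U′∌B (target z) (∈⟦⟧⁺ inBag? (inj₂ (⊆C z , t)))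
                   ; z (there t) → avoids (⊆C z) t }
      ; inBag = boundary⇒B
      }
      where
      ⊆C : ∀ {y} → Component U′ x′ y → C y
      ⊆C y = cx′ ⊕ mapWalk U′⊆U y

      boundary⇒B : ∀ {z} → Comp.Boundary U′ x′ z → z ∈ B
      boundary⇒B {z} (¬cz , y , cy , e) with walk? U x z
      ... | yes c = removed (target c) (λ z∈U′ → ¬cz (cy ▷[ e ] z∈U′))
      ... | no ¬c = ∈⟦⟧⁺ inBag? (inj₁ (¬c , y , ⊆C cy , e))
    ... | no ¬cx′ = suc a , record
      { path = path ; isPath = isPath′ ; short = short′
      ; guards = guards′ ∘ old
      ; avoids = avoids′ ∘ mapWalk U′⊆U
      ; inBag = inBag′ ∘ old
      }
      where
      a = proj₁ (guide (U′⊆U x′∈U′))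
      open Guide (proj₂ (guide (U′⊆U x′∈U′)))
        renaming (isPath to isPath′; short to short′; guards to guards′; avoids to avoids′; inBag to inBag′)

      old : ∀ {z} → Comp.Boundary U′ x′ z → Comp.Boundary U x′ z
      old {z} (¬cz , y , cy , e) = ¬cz′ , y , mapWalk U′⊆U cy , e
        where
        ¬cz′ : ¬ Component U x′ z
        -- Had `z` been in the old component, it would have been removed in this step, so it would
        -- lie in `C`, and `x′` with it.
        ¬cz′ c = ¬cx′ (B∩U⊆C (removed (target c) (λ z∈U′ → ¬cz (cy ▷[ e ] z∈U′))) (target c) ⊕ reverse c)

    next : Partial U′
    next = record
      { T = addLeaf T a₀ ; isTree = addLeaf-isTree T a₀ isTree ; bag = bag′ ; small = small′
      ; covered = covered′ ; fresh = fresh′ ; edges = edges′ ; coherent = coherent′ ; guide = guide′ }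

  complete : ∀ {U} → Acc _⊂_ U → Partial U → TreewidthAtMost G (s * maxDegree G)
  complete {U} (acc rec) D with nonempty? U
  ... | yes (x , x∈U) = complete (rec (Step.U′⊂U D x∈U)) (Step.next D x∈U)
  ... | no empty = record
    { T = T ; isTree = isTree ; bag = bag
    ; covers = λ v → covered (all v)
    ; edges = λ u v e → edges e (all u) (all v)
    ; coherent = coherent } , small
    where
    open Partial D
    all : ∀ v → v ∉ U
    all v v∈U = empty (v , v∈U)

theorem1p5 : ∀ (t : ℕ) → 4 ≤ t → ∃[ c ] (∀ (G : Graph) → (∀ ℓ → t ≤ ℓ → ¬ HasInducedCycle G ℓ) → TreewidthAtMost G (c * maxDegree G))
-- The constant is `s`, two less than the forbidden length, since a guarding path of full length `s`
-- closes to an induced cycle with at least `2 + s` vertices.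
theorem1p5 (suc (suc s)) (s≤s (s≤s 2≤s)) = s , λ G noCycle →
  let open Decompose G s 2≤s noCycle in complete (⊂-wellFounded _) initial
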